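{- Let $\langle O,\sqsubseteq,\triangleleft\rangle$ be a directed observation structure over a set $\mathbb{B}$, let $P\subseteq\mathbb{B}$ be a property and $o\in O$. Then $\mathcal{M}_P(o)=\mathsf{yes}$ if and only if $\mathcal{M}_{\Delta_{\mathsf{co}\mathbb{S}}(P)}(o)=\mathsf{yes}$.
   Context: Let $\mathbb{B}$ be a set (of behaviours). A property is a subset $P\subseteq\mathbb{B}$. An observation structure over $\mathbb{B}$ is a preordered set $\langle O,\sqsubseteq\rangle$ (of observations) together with a relation $\triangleleft\subseteq O\times\mathbb{B}$ such that: (i) $o\sqsubseteq o'$ and $o'\triangleleft b$ imply $o\triangleleft b$; (ii) for every $o\in O$ there is $b\in\mathbb{B}$ with $o\triangleleft b$. It is directed if for all $o,o'\in O$ and $b\in\mathbb{B}$ with $o\triangleleft b$ and $o'\triangleleft b$ there is $o''\in O$ with $o''\triangleleft b$, $o\sqsubseteq o''$ and $o'\sqsubseteq o''$. Put $\mathbb{B}(o)=\{b\in\mathbb{B}\mid o\triangleleft b\}$. The abstract monitor of $P$ is the function $\mathcal{M}_P:O\to\{\mathsf{yes},\mathsf{no},\mathsf{?}\}$ with $\mathcal{M}_P(o)=\mathsf{yes}$ if $\mathbb{B}(o)\subseteq P$, $\mathcal{M}_P(o)=\mathsf{no}$ if $\mathbb{B}(o)\cap P=\emptyset$, and $\mathcal{M}_P(o)=\mathsf{?}$ otherwise. $P$ is a cosafety property if for every $b\in P$ there is $o\in O$ with $o\triangleleft b$ and $\mathcal{M}_P(o)=\mathsf{yes}$. Let $\mathsf{co}\mathbb{S}$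 be the set of all cosafety properties over $\mathbb{B}$. The cosafety completion of $P$ is $\Delta_{\mathsf{co}\mathbb{S}}(P)=\bigcup\{Q\in\mathsf{co}\mathbb{S}\mid Q\subseteq P\}$. -}

module Defs where

open import Axiom.ExcludedMiddle using (ExcludedMiddle)
open import Data.Product using (∃-syntax; _×_; _,_)
open import Function.Bundles using (_⇔_; mk⇔)
open import Level using (Level; _⊔_) renaming (suc to lsuc)
open import Relation.Binary.Core using (Rel; REL)
open import Relation.Binary.PropositionalEquality using (_≡_; refl)
open import Relation.Binary.Structures using (IsPreorder)
open import Relation.Nullary using (¬_; contradiction)
import Relation.Nullary as Nullary
open import Relation.Unary using (Pred; _∈_; _⊆_; _∩_; Empty)

private
  variable
    b o r ℓ p : Level

-- The relation _◁_ takes values in the same universe Set ℓ as properties, so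
-- that the sets 𝔹 o below are themselves properties.
record ObservationStructure (B : Set b) (o r ℓ : Level)
       : Set (b ⊔ lsuc (o ⊔ r ⊔ ℓ)) where
  infix 4 _⊑_ _◁_
  field
    O          : Set o
    _⊑_        : Rel O r
    isPreorder : IsPreorder _≡_ _⊑_
    _◁_        : REL O B ℓ
    ◁-down     : ∀ {x y c} → x ⊑ y → y ◁ c → x ◁ c
    ◁-total    : ∀ x → ∃[ c ] x ◁ c

  𝔹 : O → Pred B ℓ
  𝔹 x c = x ◁ c

Directed : {B : Set b} → ObservationStructure B o r ℓ → Set (b ⊔ o ⊔ r ⊔ ℓ)
Directed S = ∀ {x y c} → x ◁ c → y ◁ c → ∃[ z ] (z ◁ c × x ⊑ z × y ⊑ z)
  where open ObservationStructure S

data Verdict : Set where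
  yes no unknown : Verdict

module Monitoring {B : Set b} (S : ObservationStructure B o r ℓ) where
  open ObservationStructure S

  infix 4 𝓜[_]_↦_

  -- The abstract monitor branches on undecidable conditions, so it is given by
  -- its graph: 𝓜[ P ] x ↦ v means that the monitor of P outputs v on x.
  -- The graph is single-valued (↦-unique) and, classically, it is the graph of
  -- the function monitor (monitor-graph).
  data 𝓜[_]_↦_ (P : Pred B p) (x : O) : Verdict → Set (b ⊔ ℓ ⊔ p) where
    is-yes     : 𝔹 x ⊆ P → 𝓜[ P ] x ↦ yes
    is-no      : Empty (𝔹 x ∩ P) → 𝓜[ P ] x ↦ no
    is-unknown : ¬ (𝔹 x ⊆ P) → ¬ Empty (𝔹 x ∩ P) → 𝓜[ P ] x ↦ unknown

  private
    ¬yes×no : (P : Pred B p) {x : O} → 𝔹 x ⊆ P → ¬ Empty (𝔹 x ∩ P)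
    ¬yes×no P {x} s e = let (c , x◁c) = ◁-total x in e c (x◁c , s x◁c)

  ↦-unique : {P : Pred B p} {x : O} {v w : Verdict} →
             𝓜[ P ] x ↦ v → 𝓜[ P ] x ↦ w → v ≡ w
  ↦-unique         (is-yes _)       (is-yes _)       = refl
  ↦-unique {P = P} (is-yes s)       (is-no e)        = contradiction e (¬yes×no P s)
  ↦-unique         (is-yes s)       (is-unknown ¬s _) = contradiction (λ {c} → s {c}) ¬s
  ↦-unique {P = P} (is-no e)        (is-yes s)       = contradiction e (¬yes×no P s)
  ↦-unique         (is-no _)        (is-no _)        = refl
  ↦-unique         (is-no e)        (is-unknown _ ¬e) = contradiction e ¬e
  ↦-unique         (is-unknown ¬s _) (is-yes s)       = contradiction (λ {c} → s {c}) ¬s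
  ↦-unique         (is-unknown _ ¬e) (is-no e)        = contradiction e ¬e
  ↦-unique         (is-unknown _ _)  (is-unknown _ _) = refl

  module _ (em : ExcludedMiddle (b ⊔ ℓ ⊔ p)) (P : Pred B p) where

    monitor : O → Verdict
    monitor x with em {𝔹 x ⊆ P} | em {Empty (𝔹 x ∩ P)}
    ... | Nullary.yes _ | _             = yes
    ... | Nullary.no _  | Nullary.yes _ = no
    ... | Nullary.no _  | Nullary.no _  = unknown

    private
      monitor-correct : ∀ x → 𝓜[ P ] x ↦ monitor x
      monitor-correct x with em {𝔹 x ⊆ P} | em {Empty (𝔹 x ∩ P)}
      ... | Nullary.yes s | _             = is-yes s
      ... | Nullary.no _  | Nullary.yes e = is-no e
      ... | Nullary.no ¬s | Nullary.no ¬e = is-unknown ¬s ¬e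

    monitor-graph : ∀ x v → monitor x ≡ v ⇔ 𝓜[ P ] x ↦ v
    monitor-graph x v =
      mk⇔ (λ { refl → monitor-correct x }) (↦-unique (monitor-correct x))

  co𝕊 : Pred (Pred B ℓ) (b ⊔ o ⊔ ℓ)
  co𝕊 P = ∀ {c} → c ∈ P → ∃[ x ] (x ◁ c × 𝓜[ P ] x ↦ yes)

  -- The union ranges over all properties in Pred B ℓ, so it lives one universe
  -- higher; 𝓜[_]_↦_ is level-polymorphic in the property for this reason.
  Δ-co𝕊 : Pred B ℓ → Pred B (b ⊔ o ⊔ lsuc ℓ)
  Δ-co𝕊 P c = ∃[ Q ] (Q ∈ co𝕊 × Q ⊆ P × c ∈ Q)

{-# OPTIONS --safe #-}
module Submission where

open import Defs
open import Data.Product using (_,_)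
open import Level using (Level)
open import Function.Base using (id)
open import Function.Bundles using (_⇔_; mk⇔)
open import Relation.Unary using (Pred; _∈_; _⊆_)

-- The behaviours compatible with an observation form a cosafety property, so once contained in `P`
-- they are among the sets united in `Δ-co𝕊 P`. The converse is `Δ-co𝕊 P ⊆ P`.

module _ {b o r ℓ : Level} {B : Set b} (S : ObservationStructure B o r ℓ) where
  open ObservationStructure S
  open Monitoring S

  -- The one observation `x` serves every behaviour in `𝔹 x`, since `𝔹 x ⊆ 𝔹 x`.
  𝔹-cosafety : ∀ x → 𝔹 x ∈ co𝕊
  𝔹-cosafety x x◁c = x , x◁c , is-yes id

  Δ-co𝕊-⊆ : (P : Pred B ℓ) → Δ-co𝕊 P ⊆ P
  Δ-co𝕊-⊆ P (Q , _ , Q⊆P , c∈Q) = Q⊆P c∈Q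

corollary2 : ∀ {b o r ℓ : Level} {B : Set b} (S : ObservationStructure B o r ℓ) → Directed S →
    let open ObservationStructure S
        open Monitoring S in
    (P : Pred B ℓ) (x : O) →
    (𝓜[ P ] x ↦ yes) ⇔ (𝓜[ Δ-co𝕊 P ] x ↦ yes)
corollary2 S _ P x = mk⇔
  -- The member of the union is `𝔹 x` itself, whatever the behaviour.
  (λ { (is-yes 𝔹x⊆P) → is-yes λ x◁c → 𝔹 x , 𝔹-cosafety S x , 𝔹x⊆P , x◁c })
  (λ { (is-yes 𝔹x⊆Δ) → is-yes λ x◁c → Δ-co𝕊-⊆ S P (𝔹x⊆Δ x◁c) })
  where
    open ObservationStructure S
    open Monitoring S
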